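{- Assume that $x\in[0,1]$ is a counterexample to the $2$-adic Littlewood conjecture, and let $w(x,2)$ be its base-$2$ expansion. Then the lengths of the overlap-free subwords of $w(x,2)$ are bounded; that is, there is a constant $L$ such that every overlap-free subword of $w(x,2)$ has length at most $L$.
   Context: A real number $x$ is a counterexample to the $2$-adic Littlewood conjecture (2LC) if $\liminf_{q\to\infty} q\cdot|q|_2\cdot\|qx\|\neq0$, where $q$ runs over the positive integers, $|\cdot|_2$ is the $2$-adic absolute value and $\|\cdot\|$ is the distance to the nearest integer. Such $x$ is irrational. For irrational $x\in[0,1]$, $w(x,2)=a_1a_2\cdots$ is the unique infinite word on $\{0,1\}$ with $x=\sum_{i\ge1}a_i2^{ -i}$. Subwords are blocks of consecutive letters. A word over an alphabet $\mathcal{A}$ is overlap-free if it contains no subword of the form $uXuXu$ with $u\in\mathcal{A}$ a letter and $X\in\mathcal{A}^*$ a (possibly empty) finite word. -}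

module Defs where

open import Data.Nat.Base as ℕ using (ℕ; zero; suc)
import Data.Nat.Properties as ℕ
open import Data.Nat.Divisibility using (_∣?_)
open import Data.Integer.Base as ℤ using (ℤ; +_; -[1+_])
import Data.Integer.Properties as ℤ
import Data.Integer.DivMod as ℤ
open import Data.Rational.Base
import Data.Rational.Unnormalised.Base as ℚᵘ
import Data.Rational.Unnormalised.Properties as ℚᵘ
open import Data.Rational.Properties
open import Data.Rational.Solver using (module +-*-Solver)
open import Data.Bool.Base using (true; false; if_then_else_)
open import Data.Fin.Base using (Fin; toℕ)
open import Data.List.Base using (List; []; _∷_; _++_; applyUpTo)
open import Data.List.Relation.Binary.Infix.Heterogeneous using (Infix)
open import Data.Product.Base using (_×_; _,_; ∃-syntax)
open import Data.Sum.Base using (_⊎_; inj₁; inj₂)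
open import Relation.Binary.Definitions using (tri<; tri≈; tri>)
open import Relation.Binary.PropositionalEquality
open import Relation.Nullary using (¬_; does)

neg-involutive : ∀ p → - - p ≡ p
neg-involutive = solve 1 (λ p → :- :- p := p) refl
  where open +-*-Solver

p≤∣p∣ : ∀ p → p ≤ ∣ p ∣
p≤∣p∣ p with ≤-total 0ℚ p
... | inj₁ 0≤p = ≤-reflexive (sym (0≤p⇒∣p∣≡p 0≤p))
... | inj₂ p≤0 = ≤-trans p≤0 (0≤∣p∣ p)

-p≤∣p∣ : ∀ p → - p ≤ ∣ p ∣
-p≤∣p∣ p = ≤-trans (p≤∣p∣ (- p)) (≤-reflexive (∣-p∣≡∣p∣ p))

∣p∣≤ : ∀ {p q} → p ≤ q → - p ≤ q → ∣ p ∣ ≤ q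
∣p∣≤ {p} {q} p≤q -p≤q with ∣p∣≡p∨∣p∣≡-p p
... | inj₁ eq = subst (_≤ q) (sym eq) p≤q
... | inj₂ eq = subst (_≤ q) (sym eq) -p≤q

/1-mono-≤ : ∀ {i j} → i ℤ.≤ j → i / 1 ≤ j / 1
/1-mono-≤ {i} {j} i≤j = toℚᵘ-cancel-≤
  (ℚᵘ.≤-respˡ-≃ (ℚᵘ.≃-sym (toℚᵘ-fromℚᵘ (ℚᵘ.mkℚᵘ i 0)))
  (ℚᵘ.≤-respʳ-≃ (ℚᵘ.≃-sym (toℚᵘ-fromℚᵘ (ℚᵘ.mkℚᵘ j 0)))
  (ℚᵘ.*≤* (ℤ.*-monoʳ-≤-nonNeg (+ 1) i≤j))))

neg-/1 : ∀ i → (ℤ.- i) / 1 ≡ - (i / 1)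
neg-/1 (+ zero)   = refl
neg-/1 (+ suc n)  = refl
neg-/1 -[1+ n ]   = sym (neg-involutive (+ suc n / 1))

suc-/1 : ∀ i → ℤ.suc i / 1 ≡ i / 1 + 1ℚ
suc-/1 i = toℚᵘ-injective (begin
  toℚᵘ (ℤ.suc i / 1)            ≈⟨ toℚᵘ-fromℚᵘ (ℚᵘ.mkℚᵘ (ℤ.suc i) 0) ⟩
  ℚᵘ.mkℚᵘ (ℤ.suc i) 0           ≈⟨ ℚᵘ.*≡* (cong (ℤ._* (+ 1)) eq) ⟩
  ℚᵘ.mkℚᵘ i 0 ℚᵘ.+ ℚᵘ.1ℚᵘ       ≈⟨ ℚᵘ.+-congˡ ℚᵘ.1ℚᵘ (toℚᵘ-fromℚᵘ (ℚᵘ.mkℚᵘ i 0)) ⟨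
  toℚᵘ (i / 1) ℚᵘ.+ toℚᵘ 1ℚ     ≈⟨ toℚᵘ-homo-+ (i / 1) 1ℚ ⟨
  toℚᵘ (i / 1 + 1ℚ)             ∎)
  where
  open ℚᵘ.≃-Reasoning
  eq : ℤ.suc i ≡ i ℤ.* (+ 1) ℤ.+ (+ 1) ℤ.* (+ 1)
  eq = trans (ℤ.+-comm (+ 1) i) (cong (ℤ._+ (+ 1)) (sym (ℤ.*-identityʳ i)))

⌊p⌋≤p : ∀ p → floor p / 1 ≤ p
⌊p⌋≤p p@record{} = toℚᵘ-cancel-≤
  (ℚᵘ.≤-respˡ-≃ (ℚᵘ.≃-sym (toℚᵘ-fromℚᵘ (ℚᵘ.mkℚᵘ (floor p) 0)))
  (ℚᵘ.*≤* (ℤ.≤-trans (ℤ.[n/d]*d≤n (↥ p) (↧ p)) (ℤ.≤-reflexive (sym (ℤ.*-identityʳ (↥ p)))))))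

p≤⌊p⌋+1 : ∀ p → p ≤ floor p / 1 + 1ℚ
p≤⌊p⌋+1 p@record{} = subst (p ≤_) (suc-/1 (floor p)) (toℚᵘ-cancel-≤
  (ℚᵘ.≤-respʳ-≃ (ℚᵘ.≃-sym (toℚᵘ-fromℚᵘ (ℚᵘ.mkℚᵘ (ℤ.suc (floor p)) 0)))
  (ℚᵘ.*≤* (ℤ.≤-trans (ℤ.≤-reflexive (ℤ.*-identityʳ (↥ p)))
    (subst (λ z → ↥ p ℤ.≤ ℤ.suc z ℤ.* ↧ p) (sym (ℤ.div-pos-is-/ℕ (↥ p) (↧ₙ p)))
      (ℤ.<⇒≤ (ℤ.n<s[n/ℕd]*d (↥ p) (↧ₙ p))))))))

p≤⌈p⌉ : ∀ p → p ≤ ceiling p / 1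
p≤⌈p⌉ p@record{} = subst₂ _≤_ (neg-involutive p) (sym (neg-/1 (floor (- p))))
  (neg-antimono-≤ (⌊p⌋≤p (- p)))

⌈p⌉≤p+1 : ∀ p → ceiling p / 1 ≤ p + 1ℚ
⌈p⌉≤p+1 p@record{} = begin
  ceiling p / 1                    ≡⟨ neg-/1 (floor (- p)) ⟩
  - f                              ≡⟨ solve 1 (λ f → :- f := :- (f :+ con 1ℚ) :+ con 1ℚ) refl f ⟩
  - (f + 1ℚ) + 1ℚ                  ≤⟨ +-monoˡ-≤ 1ℚ (neg-antimono-≤ (p≤⌊p⌋+1 (- p))) ⟩
  - - p + 1ℚ                       ≡⟨ cong (_+ 1ℚ) (neg-involutive p) ⟩
  p + 1ℚ                           ∎
  where
  open ≤-Reasoning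
  open +-*-Solver
  f = floor (- p) / 1

∥_∥ℚ : ℚ → ℚ
∥ p ∥ℚ = ∣ p - round p / 1 ∣

∥p∥≤½ : ∀ p → ∥ p ∥ℚ ≤ ½
∥p∥≤½ p with p ≤ᵇ 0ℚ
... | true  = ∣p∣≤
  (begin
    p - m            ≡⟨ solve 2 (λ p m → p :- m := p :- con ½ :- m :+ con ½) refl p m ⟩
    p - ½ - m + ½    ≤⟨ +-monoˡ-≤ ½ (+-monoˡ-≤ (- m) (p≤⌈p⌉ (p - ½))) ⟩
    m - m + ½        ≡⟨ solve 1 (λ m → m :- m :+ con ½ := con ½) refl m ⟩
    ½                ∎)
  (begin
    - (p - m)        ≡⟨ solve 2 (λ p m → :- (p :- m) := m :- p) refl p m ⟩
    m - p            ≤⟨ +-monoˡ-≤ (- p) (⌈p⌉≤p+1 (p - ½)) ⟩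
    p - ½ + 1ℚ - p   ≡⟨ solve 1 (λ p → p :- con ½ :+ con 1ℚ :- p := con ½) refl p ⟩
    ½                ∎)
  where
  open ≤-Reasoning
  open +-*-Solver
  m = ceiling (p - ½) / 1
... | false = ∣p∣≤
  (begin
    p - m            ≡⟨ solve 2 (λ p m → p :- m := p :+ con ½ :- m :- con ½) refl p m ⟩
    p + ½ - m - ½    ≤⟨ +-monoˡ-≤ (- ½) (+-monoˡ-≤ (- m) (p≤⌊p⌋+1 (p + ½))) ⟩
    m + 1ℚ - m - ½   ≡⟨ solve 1 (λ m → m :+ con 1ℚ :- m :- con ½ := con ½) refl m ⟩
    ½                ∎)
  (begin
    - (p - m)        ≡⟨ solve 2 (λ p m → :- (p :- m) := m :- p) refl p m ⟩
    m - p            ≤⟨ +-monoˡ-≤ (- p) (⌊p⌋≤p (p + ½)) ⟩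
    p + ½ - p        ≡⟨ solve 1 (λ p → p :+ con ½ :- p := con ½) refl p ⟩
    ½                ∎)
  where
  open ≤-Reasoning
  open +-*-Solver
  m = floor (p + ½) / 1

1≤j-i : ∀ {i j} → i ℤ.< j → 1ℚ ≤ j / 1 - i / 1
1≤j-i {i} {j} i<j = begin
  1ℚ                          ≡⟨ solve 1 (λ m → con 1ℚ := m :+ con 1ℚ :- m) refl (i / 1) ⟩
  i / 1 + 1ℚ - i / 1          ≡⟨ cong (_- i / 1) (suc-/1 i) ⟨
  ℤ.suc i / 1 - i / 1         ≤⟨ +-monoˡ-≤ (- (i / 1)) (/1-mono-≤ (ℤ.i<j⇒suc[i]≤j i<j)) ⟩
  j / 1 - i / 1               ∎
  where
  open ≤-Reasoning
  open +-*-Solver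

∥p∥-minimal : ∀ p (n : ℤ) → ∥ p ∥ℚ ≤ ∣ p - n / 1 ∣
∥p∥-minimal p n with ℤ.<-cmp (round p) n
... | tri≈ _ refl _ = ≤-refl
... | tri< m<n _ _  = begin
  ∥ p ∥ℚ                              ≤⟨ ∥p∥≤½ p ⟩
  1ℚ - ½                              ≤⟨ +-mono-≤ (1≤j-i m<n)
                                          (neg-antimono-≤ (≤-trans (p≤∣p∣ (p - M)) (∥p∥≤½ p))) ⟩
  N - M - (p - M)                     ≡⟨ solve 3 (λ N M p → N :- M :- (p :- M) := :- (p :- N)) refl N M p ⟩
  - (p - N)                           ≤⟨ -p≤∣p∣ (p - N) ⟩
  ∣ p - N ∣                           ∎
  where
  open ≤-Reasoning
  open +-*-Solver
  N = n / 1
  M = round p / 1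
... | tri> _ _ n<m  = begin
  ∥ p ∥ℚ                              ≤⟨ ∥p∥≤½ p ⟩
  1ℚ - ½                              ≤⟨ +-mono-≤ (1≤j-i n<m)
                                          (neg-antimono-≤ (≤-trans (-p≤∣p∣ (p - M)) (∥p∥≤½ p))) ⟩
  M - N - - (p - M)                   ≡⟨ solve 3 (λ N M p → M :- N :- (:- (p :- M)) := p :- N) refl N M p ⟩
  p - N                               ≤⟨ p≤∣p∣ (p - N) ⟩
  ∣ p - N ∣                           ∎
  where
  open ≤-Reasoning
  open +-*-Solver
  N = n / 1
  M = round p / 1

∥p∥-∥q∥≤∣p-q∣ : ∀ p q → ∥ p ∥ℚ - ∥ q ∥ℚ ≤ ∣ p - q ∣
∥p∥-∥q∥≤∣p-q∣ p q = begin
  ∥ p ∥ℚ - ∥ q ∥ℚ                   ≤⟨ +-monoˡ-≤ (- ∥ q ∥ℚ) (∥p∥-minimal p (round q)) ⟩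
  ∣ p - M ∣ - ∥ q ∥ℚ                ≡⟨ cong (λ z → ∣ z ∣ - ∥ q ∥ℚ)
                                         (solve 3 (λ p q M → p :- M := p :- q :+ (q :- M)) refl p q M) ⟩
  ∣ p - q + (q - M) ∣ - ∥ q ∥ℚ      ≤⟨ +-monoˡ-≤ (- ∥ q ∥ℚ) (∣p+q∣≤∣p∣+∣q∣ (p - q) (q - M)) ⟩
  ∣ p - q ∣ + ∥ q ∥ℚ - ∥ q ∥ℚ       ≡⟨ solve 2 (λ a b → a :+ b :- b := a) refl ∣ p - q ∣ ∥ q ∥ℚ ⟩
  ∣ p - q ∣                         ∎
  where
  open ≤-Reasoning
  open +-*-Solver
  M = round q / 1

record ℝ : Set where
  field
    approx : ℕ → ℚ
    cauchy : ∀ ε → 0ℚ < ε → ∃[ N ] (∀ m n → N ℕ.≤ m → N ℕ.≤ n → ∣ approx m - approx n ∣ ≤ ε)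

open ℝ public

infix 4 _≤ᴿ_ _<ᴿ_

_≤ᴿ_ : ℝ → ℝ → Set
x ≤ᴿ y = ∀ ε → 0ℚ < ε → ∃[ N ] (∀ n → N ℕ.≤ n → approx x n ≤ approx y n + ε)

_<ᴿ_ : ℝ → ℝ → Set
x <ᴿ y = ∃[ ε ] (0ℚ < ε × ∃[ N ] (∀ n → N ℕ.≤ n → approx x n + ε ≤ approx y n))

fromℚ : ℚ → ℝ
fromℚ p .approx _         = p
fromℚ p .cauchy ε 0<ε = 0 , λ _ _ _ _ →
  ≤-trans (≤-reflexive (cong ∣_∣ (+-inverseʳ p))) (<⇒≤ 0<ε)

0ᴿ 1ᴿ : ℝ
0ᴿ = fromℚ 0ℚ
1ᴿ = fromℚ 1ℚ

extend : (f : ℚ → ℚ) (K : ℚ) .{{_ : Positive K}} →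
         (∀ p q → ∣ f p - f q ∣ ≤ K * ∣ p - q ∣) → ℝ → ℝ
extend f K lip x .approx n     = f (approx x n)
extend f K lip x .cauchy ε 0<ε =
  let instance
        K≢0   = pos⇒nonZero K
        1/K>0 = 1/pos⇒pos K
        K≥0   = pos⇒nonNeg K
      0<δ   = subst (_< 1/ K * ε) (*-zeroʳ (1/ K)) (*-monoʳ-<-pos (1/ K) 0<ε)
      N , h = cauchy x (1/ K * ε) 0<δ
  in N , λ m n N≤m N≤n → begin
    ∣ f (approx x m) - f (approx x n) ∣   ≤⟨ lip (approx x m) (approx x n) ⟩
    K * ∣ approx x m - approx x n ∣       ≤⟨ *-monoˡ-≤-nonNeg K (h m n N≤m N≤n) ⟩
    K * (1/ K * ε)                        ≡⟨ *-assoc K (1/ K) ε ⟨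
    K * 1/ K * ε                          ≡⟨ cong (_* ε) (*-inverseʳ K) ⟩
    1ℚ * ε                                ≡⟨ *-identityˡ ε ⟩
    ε                                     ∎
  where open ≤-Reasoning

infixr 7 _·_

_·_ : ℚ → ℝ → ℝ
c · x = extend (c *_) (1ℚ + ∣ c ∣) {{K>0}} lip x
  where
  open ≤-Reasoning
  open +-*-Solver
  K>0 : Positive (1ℚ + ∣ c ∣)
  K>0 = positive (<-≤-trans (positive⁻¹ 1ℚ)
    (subst (_≤ 1ℚ + ∣ c ∣) (+-identityʳ 1ℚ) (+-monoʳ-≤ 1ℚ (0≤∣p∣ c))))
  ∣c∣≤1+∣c∣ : ∣ c ∣ ≤ 1ℚ + ∣ c ∣
  ∣c∣≤1+∣c∣ = subst (_≤ 1ℚ + ∣ c ∣) (+-identityˡ ∣ c ∣) (+-monoˡ-≤ ∣ c ∣ (<⇒≤ (positive⁻¹ 1ℚ)))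
  lip : ∀ p q → ∣ c * p - c * q ∣ ≤ (1ℚ + ∣ c ∣) * ∣ p - q ∣
  lip p q = begin
    ∣ c * p - c * q ∣           ≡⟨ cong ∣_∣ (solve 3 (λ c p q → c :* p :- c :* q := c :* (p :- q)) refl c p q) ⟩
    ∣ c * (p - q) ∣             ≡⟨ ∣p*q∣≡∣p∣*∣q∣ c (p - q) ⟩
    ∣ c ∣ * ∣ p - q ∣           ≤⟨ *-monoʳ-≤-nonNeg ∣ p - q ∣ {{∣-∣-nonNeg (p - q)}} ∣c∣≤1+∣c∣ ⟩
    (1ℚ + ∣ c ∣) * ∣ p - q ∣    ∎

∥_∥ : ℝ → ℝ
∥ x ∥ = extend ∥_∥ℚ 1ℚ lip x
  where
  open +-*-Solver
  lip : ∀ p q → ∣ ∥ p ∥ℚ - ∥ q ∥ℚ ∣ ≤ 1ℚ * ∣ p - q ∣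
  lip p q = subst (∣ ∥ p ∥ℚ - ∥ q ∥ℚ ∣ ≤_) (sym (*-identityˡ ∣ p - q ∣)) (∣p∣≤
    (∥p∥-∥q∥≤∣p-q∣ p q)
    (subst₂ _≤_ (solve 2 (λ a b → b :- a := :- (a :- b)) refl ∥ p ∥ℚ ∥ q ∥ℚ)
                (trans (cong ∣_∣ (solve 2 (λ p q → q :- p := :- (p :- q)) refl p q)) (∣-p∣≡∣p∣ (p - q)))
                (∥p∥-∥q∥≤∣p-q∣ q p)))

infix 4 _⟶_

_⟶_ : (ℕ → ℚ) → ℝ → Set
s ⟶ x = ∀ ε → 0ℚ < ε → ∃[ N ] (∀ n → N ℕ.≤ n →
  fromℚ (s n - ε) ≤ᴿ x × x ≤ᴿ fromℚ (s n + ε))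

-- The number liminf f need not exist constructively, so it is given by its
-- strict position relative to reals:
--   r < sup_N inf_{n ≥ N} f n   and   sup_N inf_{n ≥ N} f n < r.

infix 4 _<liminf_ liminf_<_ liminf_≢_

_<liminf_ : ℝ → (ℕ → ℝ) → Set
r <liminf f = ∃[ s ] (r <ᴿ s × ∃[ N ] (∀ n → N ℕ.≤ n → s ≤ᴿ f n))

liminf_<_ : (ℕ → ℝ) → ℝ → Set
liminf f < r = ∃[ s ] (s <ᴿ r × (∀ N → ∃[ n ] (N ℕ.≤ n × f n ≤ᴿ s)))

-- Inequality of reals in its usual constructive form, apartness.
liminf_≢_ : (ℕ → ℝ) → ℝ → Set
liminf f ≢ r = liminf f < r ⊎ r <liminf f

maxPow : ℕ → ℕ → ℕ
maxPow q zero    = 0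
maxPow q (suc b) = if does (2 ℕ.^ suc b ∣? q) then suc b else maxPow q b

-- maxPow q b is the largest k ≤ b with 2 ^ k ∣ q; for q ≥ 1 the bound b = q
-- loses nothing, as 2 ^ k ∣ q implies k < q.
ν₂ : ℕ → ℕ
ν₂ q = maxPow q q

∣_∣₂ : ℕ → ℚ
∣ zero ∣₂      = 0ℚ
∣ q@(suc _) ∣₂ = (+ 1 / 2 ℕ.^ ν₂ q) {{ℕ.m^n≢0 2 (ν₂ q)}}

littlewood : ℝ → ℕ → ℝ
littlewood x q = (+ q / 1) · ∣ q ∣₂ · ∥ (+ q / 1) · x ∥

-- suc: q runs over the positive integers.
Is2LCCounterexample : ℝ → Set
Is2LCCounterexample x = liminf (λ n → littlewood x (suc n)) ≢ 0ᴿ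

InfWord : Set → Set
InfWord A = ℕ → A

-- With a_{i+1} = w i, the partial sum a₁ 2⁻¹ + ⋯ + aₙ 2⁻ⁿ.
binarySum : InfWord (Fin 2) → ℕ → ℚ
binarySum w zero    = 0ℚ
binarySum w (suc n) = binarySum w n + (+ toℕ (w n) / 2 ℕ.^ suc n) {{ℕ.m^n≢0 2 (suc n)}}

_IsBinaryExpansionOf_ : InfWord (Fin 2) → ℝ → Set
w IsBinaryExpansionOf x = binarySum w ⟶ x

module _ {A : Set} where

  _IsSubwordOf_ : List A → List A → Set
  _IsSubwordOf_ = Infix _≡_

  _IsSubwordOf∞_ : List A → InfWord A → Set
  v IsSubwordOf∞ w = ∃[ i ] ∃[ n ] v ≡ applyUpTo (λ j → w (i ℕ.+ j)) n

  OverlapFree : List A → Set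
  OverlapFree v = ∀ (u : A) (X : List A) →
    ¬ ((u ∷ X ++ u ∷ X ++ u ∷ []) IsSubwordOf v)

{-# OPTIONS --safe #-}
-- Two occurrences of equal adjacent letters in an overlap-free binary word are, away from its
-- ends, an even distance apart, so the word splits into blocks 01 and 10 and is the image of an
-- overlap-free word of about half its length under the Thue-Morse morphism.  Iterating down to a
-- factor aba, a long overlap-free word contains X X̄ X with |X| = m = 2 ^ k, where X̄ is the
-- letterwise complement.  If X X̄ X follows a prefix of length j of the expansion of x, then
-- q = 2 ^ j (2 ^ m + 1) satisfies ∥ q x ∥ = O(4 ^ -m) and q ∣ q ∣₂ ≤ 2 ^ m + 1, so
-- q ∣ q ∣₂ ∥ q x ∥ = O(2 ^ -m), which a counterexample excludes for large m.
module Submission where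

open import Defs
open import Data.Fin.Base using (Fin)
open import Data.List.Base using (List; length)
open import Data.Product.Base using (_×_; _,_; ∃-syntax)

module OverlapFreeWords where

  open import Data.Fin.Base using (zero; suc; opposite)
  open import Data.Fin.Properties using (_≟_; opposite-involutive)
  open import Data.List.Base using ([]; _∷_; _++_; applyUpTo)
  open import Data.List.Relation.Binary.Infix.Heterogeneous using (here; _++ⁱ_; _ⁱ++_)
  open import Data.List.Relation.Binary.Prefix.Heterogeneous using (Prefix; []; _∷_)
  open import Data.Nat.Base
  open import Data.Nat.Properties hiding (_≟_)
  open import Data.Nat.Tactic.RingSolver using (solve-∀)
  open import Data.Sum.Base using (_⊎_; inj₁; inj₂)
  open import Function.Base using (id; _∘_)
  open import Relation.Binary.PropositionalEquality
  open import Relation.Nullary using (¬_; yes; no; contradiction)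

  -- Binary letters, and factors of words described by positions

  Word : Set
  Word = InfWord (Fin 2)

  ≢⇒≡opposite : ∀ {x y : Fin 2} → x ≢ y → x ≡ opposite y
  ≢⇒≡opposite {zero}     {zero}     x≢y = contradiction refl x≢y
  ≢⇒≡opposite {zero}     {suc zero} x≢y = refl
  ≢⇒≡opposite {suc zero} {zero}     x≢y = refl
  ≢⇒≡opposite {suc zero} {suc zero} x≢y = contradiction refl x≢y

  ≡opposite⇒≢ : ∀ {x y : Fin 2} → x ≡ opposite y → x ≢ y
  ≡opposite⇒≢ {zero}     {zero}     () refl
  ≡opposite⇒≢ {suc zero} {suc zero} () refl

  opposite-twice : ∀ {x y z : Fin 2} → x ≡ opposite y → y ≡ opposite z → x ≡ z
  opposite-twice {z = z} refl refl = opposite-involutive z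

  -- Equality of factors in terms of positions: f = id, p = suc r, ℓ = 2 + r is an overlap of
  -- period p at j, and f = opposite, ℓ = p + p is a factor X X̄ X at j with X of length p.
  Echo : (Fin 2 → Fin 2) → Word → ℕ → ℕ → ℕ → Set
  Echo f w j p ℓ = ∀ t → t < ℓ → w (t + (p + j)) ≡ f (w (t + j))

  AvoidsOverlaps : Word → ℕ → Set
  AvoidsOverlaps w n = ∀ j p → suc p + (suc p + j) < n → ¬ Echo id w j (suc p) (2 + p)

  -- Block boundaries in an overlap-free word

  module _ (w : Word) {n : ℕ} (av : AvoidsOverlaps w n) where

    -- A third equal letter would complete aaa, the overlap with empty `X`.
    aa⇒aab : ∀ i → 2 + i < n → w (1 + i) ≡ w i → w (2 + i) ≡ opposite (w (1 + i))
    aa⇒aab i 2+i<n e₁ = ≢⇒≡opposite λ e₂ → av i 0 2+i<n λ where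
      0 _ → e₁
      1 _ → e₂
      (suc (suc _)) (s≤s (s≤s ()))

    -- A fifth alternating letter would complete the overlap ababa of period 2.
    abab⇒ababb : ∀ i → 4 + i < n → w (1 + i) ≡ opposite (w i) →
                 w (2 + i) ≡ opposite (w (1 + i)) → w (3 + i) ≡ opposite (w (2 + i)) →
                 w (4 + i) ≡ w (3 + i)
    abab⇒ababb i 4+i<n e₁ e₂ e₃ with w (4 + i) ≟ w (3 + i)
    ... | yes e₄ = e₄
    ... | no ≢₄  = contradiction echo (av i 1 4+i<n)
      where
      echo : Echo id w i 2 3
      echo 0 _ = opposite-twice e₂ e₁
      echo 1 _ = opposite-twice e₃ e₂
      echo 2 _ = opposite-twice (≢⇒≡opposite ≢₄) e₃
      echo (suc (suc (suc _))) (s≤s (s≤s (s≤s ())))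

    -- The leading letter must be b, since aaa is excluded, so the factor begins baaba. If another a
    -- came next, aaa would again be excluded and b would follow, giving the overlap baabaab of
    -- period 3. The bound `6 + i < n` leaves room for its last letter.
    ?aaba⇒?aabab : ∀ i → 6 + i < n → w (2 + i) ≡ w (1 + i) →
                   w (3 + i) ≡ opposite (w (2 + i)) → w (4 + i) ≡ opposite (w (3 + i)) →
                   w (5 + i) ≡ opposite (w (4 + i))
    ?aaba⇒?aabab i 6+i<n e₂ e₃ e₄ = ≢⇒≡opposite λ e₅ → av i 2 6+i<n λ where
        0 _ → trans e₃ (trans (cong opposite e₂) (sym b≡))
        1 _ → trans (opposite-twice e₄ e₃) e₂
        2 _ → trans e₅ (opposite-twice e₄ e₃)
        3 _ → trans (aa⇒aab (4 + i) 6+i<n e₅)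
          (trans (cong opposite (trans e₅ (opposite-twice {z = w (2 + i)} e₄ e₃))) (sym e₃))
        (suc (suc (suc (suc _)))) (s≤s (s≤s (s≤s (s≤s ()))))
      where
      3+i<n = <-trans (n<1+n (3 + i)) (<-trans (n<1+n (4 + i)) (<-trans (n<1+n (5 + i)) 6+i<n))
      b≡ : w i ≡ opposite (w (1 + i))
      b≡ with w i ≟ w (1 + i)
      ... | no ≢₁ = ≢⇒≡opposite ≢₁
      ... | yes e₁ = contradiction e₂ (≡opposite⇒≢ (aa⇒aab i (<-trans (n<1+n (2 + i)) 3+i<n) (sym e₁)))

    -- Cut i: the block decomposition has a boundary between positions 1 + i and 2 + i.
    -- The letters there are equal, or else the last two equal letters are two positions earlier.
    data Cut : ℕ → Set where
      double : ∀ {i} → w (2 + i) ≡ w (1 + i) → Cut i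
      single : ∀ {i} → w (2 + i) ≡ w (1 + i) → w (3 + i) ≡ opposite (w (2 + i)) →
               w (4 + i) ≡ opposite (w (3 + i)) → w (5 + i) ≡ opposite (w (4 + i)) → Cut (2 + i)

    -- After a pair aa across the boundary the word goes on as bb.. or as bab; the first has a pair
    -- across the next boundary, the second is `single`. After `single` the last four letters read
    -- abab, so the following letter repeats the last one and a pair again lies across the next
    -- boundary.
    next-cut : ∀ {i} → 6 + i < n → Cut i → Cut (2 + i)
    next-cut {i} 6+i<n (double e₂) with w (4 + i) ≟ w (3 + i)
    ... | yes e₄ = double e₄
    ... | no ≢₄  = single e₂ e₃ e₄ (?aaba⇒?aabab i 6+i<n e₂ e₃ e₄)
      where
      e₃ = aa⇒aab (1 + i) (≤-trans (+-monoˡ-≤ i (s≤s (s≤s (s≤s (s≤s z≤n))))) 6+i<n) e₂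
      e₄ = ≢⇒≡opposite ≢₄
    next-cut 6+i<n (single {i} e₂ e₃ e₄ e₅) =
      double (abab⇒ababb (2 + i) (≤-trans (m≤n+m (7 + i) 2) 6+i<n) e₃ e₄ e₅)

    cut⇒block : ∀ {i} → 3 + i < n → Cut i → w (3 + i) ≡ opposite (w (2 + i))
    cut⇒block 3+i<n (double e₂)         = aa⇒aab _ 3+i<n e₂
    cut⇒block 3+i<n (single _ _ _ e₅)   = e₅

    -- Five letters without an equal adjacent pair would be ababa. The search starts at position 1,
    -- not 0, because `?aaba⇒?aabab` looks at the letter before the pair.
    first-cut : 5 < n → ∃[ i ] (i ≤ 3 × Cut i)
    first-cut 5<n with w 2 ≟ w 1 | w 3 ≟ w 2 | w 4 ≟ w 3
    ... | yes e | _     | _     = 0 , z≤n , double e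
    ... | no _  | yes e | _     = 1 , s≤s z≤n , double e
    ... | no _  | no _  | yes e = 2 , s≤s (s≤s z≤n) , double e
    ... | no a  | no b  | no c  = 3 , ≤-refl , double
      (abab⇒ababb 1 5<n (≢⇒≡opposite a) (≢⇒≡opposite b) (≢⇒≡opposite c))

    cuts : ∀ {i} → Cut i → ∀ k → 4 + (k + k + i) < n → Cut (k + k + i)
    cuts     c zero    _     = c
    cuts {i} c (suc k) bound rewrite +-suc k k =
      next-cut bound (cuts c k (≤-trans (m≤n+m (5 + (k + k + i)) 2) bound))

    cut-blocks : ∀ {i} → Cut i → ∀ k → 4 + (k + k + i) < n →
             w (3 + (k + k + i)) ≡ opposite (w (2 + (k + k + i)))
    cut-blocks c k bound = cut⇒block (<-trans (n<1+n _) bound) (cuts c k bound)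

  -- Undoing the Thue-Morse morphism

  halve : ∀ t → ∃[ s ] (t ≡ s + s ⊎ t ≡ 1 + (s + s))
  halve zero    = 0 , inj₁ refl
  halve (suc t) with halve t
  ... | s , inj₁ refl = s , inj₂ refl
  ... | s , inj₂ refl = suc s , inj₁ (cong suc (sym (+-suc s s)))

  +-double-cancel-< : ∀ {s ℓ} → s + s < ℓ + ℓ → s < ℓ
  +-double-cancel-< {s} {ℓ} 2s<2ℓ with s <? ℓ
  ... | yes s<ℓ = s<ℓ
  ... | no s≮ℓ  = contradiction (+-mono-≤ (≮⇒≥ s≮ℓ) (≮⇒≥ s≮ℓ)) (<⇒≱ 2s<2ℓ)

  Blocks : Word → ℕ → ℕ → Set
  Blocks w c n = ∀ k → k < n → w (1 + (k + k + c)) ≡ opposite (w (k + k + c))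

  blocks-exist : ∀ w n → AvoidsOverlaps w (n + n + 10) → ∃[ c ] (c ≤ 5 × Blocks w c n)
  blocks-exist w n av with first-cut w av (m≤n⇒m≤o+n (n + n) (m≤n+m 6 4))
  -- The blocks start at `2 + i`, the first position after the boundary of `Cut i`.
  ... | i , i≤3 , cut = 2 + i , s≤s (s≤s i≤3) , λ k k<n →
    subst (λ z → w (suc z) ≡ opposite (w z)) (lemma₁ k i)
      (cut-blocks w av cut k (begin
        5 + (k + k + i)         ≤⟨ +-monoʳ-≤ 5 (+-monoʳ-≤ (k + k) i≤3) ⟩
        5 + (k + k + 3)         ≡⟨ lemma₂ k ⟩
        suc k + suc k + 6       ≤⟨ +-monoˡ-≤ 6 (+-mono-≤ k<n k<n) ⟩
        n + n + 6               ≤⟨ +-monoʳ-≤ (n + n) (m≤m+n 6 4) ⟩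
        n + n + 10              ∎))
    where
    open ≤-Reasoning
    lemma₁ : ∀ k i → 2 + (k + k + i) ≡ k + k + (2 + i)
    lemma₁ = solve-∀
    lemma₂ : ∀ k → 5 + (k + k + 3) ≡ suc k + suc k + 6
    lemma₂ = solve-∀

  -- Even offsets compare first letters of blocks, which are the letters of the halved word. Odd
  -- offsets compare second letters, the complements of the first ones, so `f` has to commute with
  -- `opposite`. Taking `f = id` carries overlaps from the halved word up to `w`, and `f = opposite`
  -- does the same for factors X X̄ X.
  echo-double : ∀ f w {c n} → (∀ x → f (opposite x) ≡ opposite (f x)) → Blocks w c n →
                ∀ j p ℓ → ℓ + (p + j) ≤ n → Echo f (λ k → w (k + k + c)) j p ℓ →
                Echo f w (j + j + c) (p + p) (ℓ + ℓ)
  echo-double f w {c} comm blocks j p ℓ bound echo t t<2ℓ with halve t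
  ... | s , inj₁ refl = begin
    w (s + s + (p + p + (j + j + c)))        ≡⟨ cong w (lemma₁ s p j c) ⟩
    w (s + (p + j) + (s + (p + j)) + c)      ≡⟨ echo s s<ℓ ⟩
    f (w (s + j + (s + j) + c))              ≡⟨ cong (f ∘ w) (lemma₂ s j c) ⟨
    f (w (s + s + (j + j + c)))              ∎
    where
    open ≡-Reasoning
    s<ℓ = +-double-cancel-< t<2ℓ
    lemma₁ : ∀ s p j c → s + s + (p + p + (j + j + c)) ≡ s + (p + j) + (s + (p + j)) + c
    lemma₁ = solve-∀
    lemma₂ : ∀ s j c → s + s + (j + j + c) ≡ s + j + (s + j) + c
    lemma₂ = solve-∀
  ... | s , inj₂ refl = begin
    w (1 + (s + s + (p + p + (j + j + c))))           ≡⟨ cong (w ∘ suc) (lemma₁ s p j c) ⟩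
    w (1 + (s + (p + j) + (s + (p + j)) + c))         ≡⟨ blocks (s + (p + j)) (<-≤-trans (+-monoˡ-< (p + j) s<ℓ) bound) ⟩
    opposite (w (s + (p + j) + (s + (p + j)) + c))    ≡⟨ cong opposite (echo s s<ℓ) ⟩
    opposite (f (w (s + j + (s + j) + c)))            ≡⟨ comm _ ⟨
    f (opposite (w (s + j + (s + j) + c)))            ≡⟨ cong f (blocks (s + j) (<-≤-trans (+-mono-<-≤ s<ℓ (m≤n+m j p)) bound)) ⟨
    f (w (1 + (s + j + (s + j) + c)))                 ≡⟨ cong (f ∘ w ∘ suc) (lemma₂ s j c) ⟨
    f (w (1 + (s + s + (j + j + c))))                 ∎
    where
    open ≡-Reasoning
    s<ℓ = +-double-cancel-< (<-trans (n<1+n (s + s)) t<2ℓ)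
    lemma₁ : ∀ s p j c → s + s + (p + p + (j + j + c)) ≡ s + (p + j) + (s + (p + j)) + c
    lemma₁ = solve-∀
    lemma₂ : ∀ s j c → s + s + (j + j + c) ≡ s + j + (s + j) + c
    lemma₂ = solve-∀

  avoids-halve : ∀ w {c n} → c ≤ 5 → Blocks w c n → AvoidsOverlaps w (n + n + 10) →
                 AvoidsOverlaps (λ k → w (k + k + c)) n
  avoids-halve w {c} {n} c≤5 blocks av j p bound echo =
    av (j + j + c) (p + suc p) (begin-strict
      2p + (2p + (j + j + c))                     ≤⟨ +-monoʳ-≤ 2p (+-monoʳ-≤ 2p (+-monoʳ-≤ (j + j) c≤5)) ⟩
      2p + (2p + (j + j + 5))                     ≡⟨ lemma (suc p) j ⟩
      suc p + (suc p + j) + (suc p + (suc p + j)) + 5   <⟨ +-mono-<-≤ (+-mono-< bound bound) (m≤m+n 5 5) ⟩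
      n + n + 10                                  ∎)
      -- Doubling gives `4 + 2p` agreements at period `2 + 2p`, one more than an overlap of that
      -- period consists of; the last one is dropped.
      λ t t<ℓ → echo-double id w (λ _ → refl) blocks j (suc p) (2 + p) bound echo t
        (≤-trans t<ℓ (+-monoʳ-≤ (2 + p) (n≤1+n (suc p))))
    where
    open ≤-Reasoning
    2p = suc p + suc p
    lemma : ∀ q j → q + q + (q + q + (j + j + 5)) ≡ q + (q + j) + (q + (q + j)) + 5
    lemma = solve-∀

  -- Long factors X X̄ X

  aba-exists : ∀ w → AvoidsOverlaps w 10 → ∃[ j ] (3 + j ≤ 10 × Echo opposite w j 1 2)
  aba-exists w av with anyUpTo? (λ t → w (2 + t) ≟ w t) 7
  -- Without a factor aba, letters two apart are complementary, so letters four apart agree: the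
  -- first nine letters form an overlap of period 4.
  ... | no ∄ = contradiction echo (av 0 3 (n≤1+n 9))
    where
    step : ∀ {t} → t < 7 → w (2 + t) ≡ opposite (w t)
    step t<7 = ≢⇒≡opposite λ e → ∄ (_ , t<7 , e)
    echo : Echo id w 0 4 5
    echo t t<5 rewrite +-identityʳ t | +-comm t 4 =
      opposite-twice (step {2 + t} (s≤s (s≤s t<5))) (step {t} (<-≤-trans t<5 (m≤n+m 5 2)))
  ... | yes (t , t<7 , e) = t , +-monoʳ-≤ 3 (<⇒≤ t<7) , λ where
      0 _ → ≢⇒≡opposite 1+t≢t
      1 _ → trans e (≢⇒≡opposite (1+t≢t ∘ sym))
      (suc (suc _)) (s≤s (s≤s ()))
    where
    1+t≢t : w (1 + t) ≢ w t
    1+t≢t e₁ = ≡opposite⇒≢ (aa⇒aab w av t (s≤s (s≤s (≤-trans t<7 (n≤1+n 7)))) e₁) (trans e (sym e₁))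

  -- The factor is found in the halved word by induction and doubled back. At most five letters
  -- precede the first block, so `n + n + 10` letters suffice for `n` blocks. The length `m` starts
  -- at 1 and doubles at each level, hence stays above `k`. The length `n` is fixed before `w`,
  -- which makes the final bound uniform.
  long-XX̄X : ∀ k → ∃[ n ] (∀ w → AvoidsOverlaps w n →
    ∃[ j ] ∃[ m ] (k < m × m + m + (m + j) ≤ n × Echo opposite w j m (m + m)))
  long-XX̄X zero = 10 , λ w av → let j , bound , echo = aba-exists w av in j , 1 , ≤-refl , bound , echo
  long-XX̄X (suc k) with long-XX̄X k
  ... | n , find = n + n + 10 , λ w av →
    let c , c≤5 , blocks         = blocks-exist w n av
        j , m , k<m , b , echo = find (λ k → w (k + k + c)) (avoids-halve w c≤5 blocks av)
    in j + j + c , m + m , +-mono-≤-< (≤-trans (s≤s z≤n) k<m) k<m ,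
       (begin
         m + m + (m + m) + (m + m + (j + j + c))    ≡⟨ lemma m j c ⟩
         m + m + (m + j) + (m + m + (m + j)) + c    ≤⟨ +-mono-≤ (+-mono-≤ b b) (≤-trans c≤5 (m≤m+n 5 5)) ⟩
         n + n + 10                                 ∎) ,
       echo-double opposite w (λ _ → refl) blocks j m (m + m) b echo
    where
    open ≤-Reasoning
    lemma : ∀ m j c → m + m + (m + m) + (m + m + (j + j + c)) ≡ m + m + (m + j) + (m + m + (m + j)) + c
    lemma = solve-∀

  -- From overlaps by positions to overlaps in lists

  applyUpTo-++ : ∀ {A : Set} (f : ℕ → A) m n →
                 applyUpTo f (m + n) ≡ applyUpTo f m ++ applyUpTo (f ∘ (m +_)) n
  applyUpTo-++ f zero    n = refl
  applyUpTo-++ f (suc m) n = cong (f 0 ∷_) (applyUpTo-++ (f ∘ suc) m n)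

  applyUpTo-cong-< : ∀ {A : Set} {f g : ℕ → A} n → (∀ {t} → t < n → f t ≡ g t) →
                     applyUpTo f n ≡ applyUpTo g n
  applyUpTo-cong-< zero    eq = refl
  applyUpTo-cong-< (suc n) eq = cong₂ _∷_ (eq (s≤s z≤n)) (applyUpTo-cong-< n (eq ∘ s≤s))

  ≡⇒prefix : ∀ {A : Set} {xs ys : List A} → xs ≡ ys → Prefix _≡_ xs ys
  ≡⇒prefix {xs = []}     refl = []
  ≡⇒prefix {xs = x ∷ xs} refl = refl ∷ ≡⇒prefix refl

  applyUpTo-factor : ∀ {A : Set} (f : ℕ → A) j m {n} → j + m ≤ n →
                     applyUpTo (f ∘ (j +_)) m IsSubwordOf applyUpTo f n
  applyUpTo-factor f j m {n} j+m≤n with m≤n⇒∃[o]m+o≡n j+m≤n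
  ... | r , refl = subst (applyUpTo (f ∘ (j +_)) m IsSubwordOf_)
    (sym (trans (applyUpTo-++ f (j + m) r) (cong (_++ applyUpTo (f ∘ (j + m +_)) r) (applyUpTo-++ f j m))))
    ((applyUpTo f j ++ⁱ here (≡⇒prefix refl)) ⁱ++ _)

  overlap-shape : ∀ {A : Set} (f : ℕ → A) p → (∀ {t} → t < 2 + p → f (t + suc p) ≡ f t) →
    let X = applyUpTo (f ∘ suc) p in
    f 0 ∷ X ++ f 0 ∷ X ++ f 0 ∷ [] ≡ applyUpTo f (suc p + (suc p + 1))
  overlap-shape f p eq = begin
    block ++ block ++ f 0 ∷ []                                      ≡⟨ cong (λ z → block ++ block ++ z ∷ []) last≡ ⟨
    block ++ block ++ f (suc p + (suc p + 0)) ∷ []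
      ≡⟨ cong (λ z → block ++ z ++ f (suc p + (suc p + 0)) ∷ []) (applyUpTo-cong-< (suc p) period) ⟨
    block ++ applyUpTo (f ∘ (suc p +_)) (suc p) ++ f (suc p + (suc p + 0)) ∷ []
      ≡⟨ cong (block ++_) (applyUpTo-++ (f ∘ (suc p +_)) (suc p) 1) ⟨
    block ++ applyUpTo (f ∘ (suc p +_)) (suc p + 1)                 ≡⟨ applyUpTo-++ f (suc p) (suc p + 1) ⟨
    applyUpTo f (suc p + (suc p + 1))                               ∎
    where
    open ≡-Reasoning
    block = applyUpTo f (suc p)
    period : ∀ {t} → t < suc p → f (suc p + t) ≡ f t
    period {t} t<1+p = trans (cong f (+-comm (suc p) t)) (eq (≤-trans t<1+p (n≤1+n (suc p))))
    last≡ : f (suc p + (suc p + 0)) ≡ f 0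
    -- The last letter is moved back by two periods; the first of these moves uses the final
    -- agreement, `t = suc p`.
    last≡ = trans (cong (λ z → f (suc p + z)) (+-identityʳ (suc p)))
      (trans (eq ≤-refl) (eq (s≤s z≤n)))

  overlapFree⇒avoids : ∀ (w : Word) n → OverlapFree (applyUpTo w n) → AvoidsOverlaps w n
  overlapFree⇒avoids w n free j p bound echo = free (f 0) (applyUpTo (f ∘ suc) p)
    (subst (_IsSubwordOf applyUpTo w n) (sym (overlap-shape f p echo′))
      (applyUpTo-factor w j (suc p + (suc p + 1)) (subst (_≤ n) (lemma (suc p) j) bound)))
    where
    f = w ∘ (j +_)
    echo′ : ∀ {t} → t < 2 + p → f (t + suc p) ≡ f t
    echo′ {t} t<2+p = trans (cong w (shift j t (suc p))) (trans (echo t t<2+p) (cong w (+-comm t j)))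
      where
      shift : ∀ j t q → j + (t + q) ≡ t + (q + j)
      shift = solve-∀
    lemma : ∀ q j → suc (q + (q + j)) ≡ j + (q + (q + 1))
    lemma = solve-∀

module Approximation where

  open OverlapFreeWords
  open import Data.Fin.Base using (zero; suc; opposite; toℕ)
  open import Data.Integer.Base as ℤ using (+_)
  import Data.Integer.Properties as ℤ
  open import Data.Nat.Base as ℕ using (ℕ; zero; suc)
  import Data.Nat.Properties as ℕ
  open import Data.List.Properties using (length-applyUpTo)
  open import Data.Nat.Divisibility using (_∣_; _∣?_; m∣m*n; ∣⇒≤)
  open import Data.Nat.Tactic.RingSolver using (solve-∀)
  open import Data.Product.Base using (proj₁; proj₂)
  open import Data.Sum.Base using (inj₁; inj₂)
  open import Data.Rational.Base
  open import Data.Rational.Properties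
  open import Data.Rational.Solver using (module +-*-Solver)
  import Data.Rational.Unnormalised.Base as ℚᵘ
  import Data.Rational.Unnormalised.Properties as ℚᵘ
  open import Function.Base using (_∘_)
  open import Relation.Binary.PropositionalEquality hiding (J)
  open import Relation.Nullary using (yes; no; contradiction)
  open import Relation.Nullary.Decidable using (from-yes)

  -- Integers written in binary by factors of a word

  prefix : Word → ℕ → ℕ
  prefix w zero    = 0
  prefix w (suc n) = 2 ℕ.* prefix w n ℕ.+ toℕ (w n)

  prefix-+ : ∀ w m n → prefix w (m ℕ.+ n) ≡ prefix w m ℕ.* 2 ℕ.^ n ℕ.+ prefix (w ∘ (m ℕ.+_)) n
  prefix-+ w m zero rewrite ℕ.+-identityʳ m = lemma (prefix w m)
    where
    lemma : ∀ a → a ≡ a ℕ.* 1 ℕ.+ 0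
    lemma = solve-∀
  prefix-+ w m (suc n) rewrite ℕ.+-suc m n | prefix-+ w m n =
    lemma (prefix w m) (2 ℕ.^ n) (prefix (w ∘ (m ℕ.+_)) n) (toℕ (w (m ℕ.+ n)))
    where
    lemma : ∀ a b c d → 2 ℕ.* (a ℕ.* b ℕ.+ c) ℕ.+ d ≡ a ℕ.* (2 ℕ.* b) ℕ.+ (2 ℕ.* c ℕ.+ d)
    lemma = solve-∀

  toℕ-opposite : ∀ (x : Fin 2) → toℕ x ℕ.+ toℕ (opposite x) ≡ 1
  toℕ-opposite zero       = refl
  toℕ-opposite (suc zero) = refl

  -- Complementary digits add up to 1 in every place, so the two integers add up to the number with
  -- `n` binary digits 1.
  prefix-opposite : ∀ w v n → (∀ t → t ℕ.< n → v t ≡ opposite (w t)) →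
                    suc (prefix w n ℕ.+ prefix v n) ≡ 2 ℕ.^ n
  prefix-opposite w v zero    eq = refl
  prefix-opposite w v (suc n) eq = begin
    suc (2 ℕ.* a ℕ.+ x ℕ.+ (2 ℕ.* b ℕ.+ y))   ≡⟨ cong suc (lemma a b x y) ⟩
    suc (2 ℕ.* (a ℕ.+ b) ℕ.+ (x ℕ.+ y))       ≡⟨ cong (λ z → suc (2 ℕ.* (a ℕ.+ b) ℕ.+ z)) x+y≡1 ⟩
    suc (2 ℕ.* (a ℕ.+ b) ℕ.+ 1)               ≡⟨ lemma′ (a ℕ.+ b) ⟩
    2 ℕ.* suc (a ℕ.+ b)                       ≡⟨ cong (2 ℕ.*_) (prefix-opposite w v n λ t t<n → eq t (ℕ.m<n⇒m<1+n t<n)) ⟩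
    2 ℕ.^ suc n                               ∎
    where
    open ≡-Reasoning
    a = prefix w n
    b = prefix v n
    x = toℕ (w n)
    y = toℕ (v n)
    x+y≡1 : x ℕ.+ y ≡ 1
    x+y≡1 = trans (cong (λ z → x ℕ.+ toℕ z) (eq n ℕ.≤-refl)) (toℕ-opposite (w n))
    lemma : ∀ a b x y → 2 ℕ.* a ℕ.+ x ℕ.+ (2 ℕ.* b ℕ.+ y) ≡ 2 ℕ.* (a ℕ.+ b) ℕ.+ (x ℕ.+ y)
    lemma = solve-∀
    lemma′ : ∀ c → suc (2 ℕ.* c ℕ.+ 1) ≡ 2 ℕ.* suc c
    lemma′ = solve-∀

  prefix<2^n : ∀ w n → prefix w n ℕ.< 2 ℕ.^ n
  prefix<2^n w n = subst (suc (prefix w n) ℕ.≤_) (prefix-opposite w (opposite ∘ w) n λ _ _ → refl)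
    (ℕ.s≤s (ℕ.m≤m+n (prefix w n) _))

  n<2^n : ∀ n → n ℕ.< 2 ℕ.^ n
  n<2^n zero    = ℕ.s≤s ℕ.z≤n
  n<2^n (suc n) = ℕ.+-mono-≤-< (ℕ.m^n>0 2 n) (ℕ.<-≤-trans (n<2^n n) (ℕ.m≤m+n _ 0))

  -- With P = 2 ^ m and X + X̄ = P - 1, the number V = X P ^ 2 + X̄ P + X written X X̄ X satisfies
  -- (P + 1) V = (X + 1) P ^ 3 - (P - X); the subtraction is moved to the left as d.
  XX̄X-prefix : ∀ w j m → Echo opposite w j m (m ℕ.+ m) → let P = 2 ℕ.^ m in
    ∃[ I ] ∃[ d ] (d ℕ.≤ P ×
      (P ℕ.+ 1) ℕ.* prefix w (j ℕ.+ (m ℕ.+ (m ℕ.+ m))) ℕ.+ d ≡ P ℕ.* P ℕ.* P ℕ.* I)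
  XX̄X-prefix w j m echo =
    -- Here `suc Y` is P - X. The letters before the factor have value `A` and contribute (P + 1) A
    -- P ^ 3, already a multiple of P ^ 3.
    (P ℕ.+ 1) ℕ.* A ℕ.+ X ℕ.+ 1 , suc Y , subst (suc Y ℕ.≤_) X+Y (ℕ.s≤s (ℕ.m≤n+m Y X)) ,
    trans (cong (λ z → (P ℕ.+ 1) ℕ.* z ℕ.+ suc Y) split)
      (lemma P X+Y)
    where
    P  = 2 ℕ.^ m
    A  = prefix w j
    w₁ = w ∘ (j ℕ.+_)
    w₂ = w₁ ∘ (m ℕ.+_)
    w₃ = w₂ ∘ (m ℕ.+_)
    X  = prefix w₁ m
    Y  = prefix w₂ m
    opp : ∀ t → t ℕ.< m ℕ.+ m → w (j ℕ.+ (m ℕ.+ t)) ≡ opposite (w (j ℕ.+ t))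
    opp t t<2m = trans (cong w (shift j m t)) (trans (echo t t<2m) (cong (opposite ∘ w) (ℕ.+-comm t j)))
      where
      shift : ∀ j m t → j ℕ.+ (m ℕ.+ t) ≡ t ℕ.+ (m ℕ.+ j)
      shift = solve-∀
    X+Y : suc (X ℕ.+ Y) ≡ P
    X+Y = prefix-opposite w₁ w₂ m λ t t<m → opp t (ℕ.m≤n⇒m≤n+o m t<m)
    Y+Z : suc (Y ℕ.+ prefix w₃ m) ≡ P
    Y+Z = prefix-opposite w₂ w₃ m λ t t<m → opp (m ℕ.+ t) (ℕ.+-monoʳ-< m t<m)
    Z≡X : prefix w₃ m ≡ X
    Z≡X = ℕ.+-cancelˡ-≡ Y _ _ (trans (ℕ.suc-injective (trans Y+Z (sym X+Y))) (ℕ.+-comm X Y))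
    split : prefix w (j ℕ.+ (m ℕ.+ (m ℕ.+ m))) ≡
            A ℕ.* (P ℕ.* (P ℕ.* P)) ℕ.+ (X ℕ.* (P ℕ.* P) ℕ.+ (Y ℕ.* P ℕ.+ X))
    split rewrite prefix-+ w j (m ℕ.+ (m ℕ.+ m)) | prefix-+ w₁ m (m ℕ.+ m) | prefix-+ w₂ m m
                | ℕ.^-distribˡ-+-* 2 m (m ℕ.+ m) | ℕ.^-distribˡ-+-* 2 m m | Z≡X = refl
    lemma : ∀ P → suc (X ℕ.+ Y) ≡ P →
      (P ℕ.+ 1) ℕ.* (A ℕ.* (P ℕ.* (P ℕ.* P)) ℕ.+ (X ℕ.* (P ℕ.* P) ℕ.+ (Y ℕ.* P ℕ.+ X))) ℕ.+ suc Y
        ≡ P ℕ.* P ℕ.* P ℕ.* ((P ℕ.+ 1) ℕ.* A ℕ.+ X ℕ.+ 1)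
    lemma P refl = trans (expand P A X Y)
      (trans (cong (P ℕ.* P ℕ.* P ℕ.* ((P ℕ.+ 1) ℕ.* A ℕ.+ X) ℕ.+_) (cube (X ℕ.+ Y)))
        (collect (P ℕ.* P ℕ.* P) ((P ℕ.+ 1) ℕ.* A ℕ.+ X)))
      where
      expand : ∀ P A X Y →
        (P ℕ.+ 1) ℕ.* (A ℕ.* (P ℕ.* (P ℕ.* P)) ℕ.+ (X ℕ.* (P ℕ.* P) ℕ.+ (Y ℕ.* P ℕ.+ X))) ℕ.+ suc Y
          ≡ P ℕ.* P ℕ.* P ℕ.* ((P ℕ.+ 1) ℕ.* A ℕ.+ X) ℕ.+
            ((X ℕ.+ Y) ℕ.* (P ℕ.* P) ℕ.+ (X ℕ.+ Y) ℕ.* P ℕ.+ suc (X ℕ.+ Y))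
      expand = solve-∀
      -- With s = X + Y = P - 1, the terms left over by `expand` telescope to P ^ 3.
      cube : ∀ s → s ℕ.* (suc s ℕ.* suc s) ℕ.+ s ℕ.* suc s ℕ.+ suc s ≡ suc s ℕ.* suc s ℕ.* suc s
      cube = solve-∀
      collect : ∀ q b → q ℕ.* b ℕ.+ q ≡ q ℕ.* (b ℕ.+ 1)
      collect = solve-∀

  -- The 2-adic absolute value, and natural numbers as rationals

  maxPow-maximal : ∀ q k b → 2 ℕ.^ k ∣ q → k ℕ.≤ b → k ℕ.≤ maxPow q b
  maxPow-maximal q k zero    2^k∣q k≤b = k≤b
  maxPow-maximal q k (suc b) 2^k∣q k≤b with 2 ℕ.^ suc b ∣? q
  ... | yes _ = k≤b
  ... | no ∤q with ℕ.m≤n⇒m<n∨m≡n k≤b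
  ...   | inj₁ k<1+b = maxPow-maximal q k b 2^k∣q (ℕ.s≤s⁻¹ k<1+b)
  ...   | inj₂ refl  = contradiction 2^k∣q ∤q

  -- Opaque, as unfolding ι n exposes a gcd computation that stalls unification.
  opaque
    ι : ℕ → ℚ
    ι n = + n / 1

    ι-def : ∀ n → ι n ≡ + n / 1
    ι-def n = refl

    ι-mono : ∀ {m n} → m ℕ.≤ n → ι m ≤ ι n
    ι-mono m≤n = /1-mono-≤ (ℤ.+≤+ m≤n)

    toℚᵘ-ι : ∀ n → toℚᵘ (ι n) ℚᵘ.≃ ℚᵘ.mkℚᵘ (+ n) 0
    toℚᵘ-ι n = toℚᵘ-fromℚᵘ (ℚᵘ.mkℚᵘ (+ n) 0)

  ι-+ : ∀ m n → ι (m ℕ.+ n) ≡ ι m + ι n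
  ι-+ m n = toℚᵘ-injective (begin
    toℚᵘ (ι (m ℕ.+ n))                               ≈⟨ toℚᵘ-ι (m ℕ.+ n) ⟩
    ℚᵘ.mkℚᵘ (+ (m ℕ.+ n)) 0                          ≈⟨ ℚᵘ.*≡* (cong (ℤ._* (+ 1)) eq) ⟩
    ℚᵘ.mkℚᵘ (+ m) 0 ℚᵘ.+ ℚᵘ.mkℚᵘ (+ n) 0             ≈⟨ ℚᵘ.+-cong (toℚᵘ-ι m) (toℚᵘ-ι n) ⟨
    toℚᵘ (ι m) ℚᵘ.+ toℚᵘ (ι n)                       ≈⟨ toℚᵘ-homo-+ (ι m) (ι n) ⟨
    toℚᵘ (ι m + ι n)                                 ∎)
    where
    open ℚᵘ.≃-Reasoning
    eq : + (m ℕ.+ n) ≡ (+ m) ℤ.* (+ 1) ℤ.+ (+ n) ℤ.* (+ 1)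
    eq = sym (cong₂ ℤ._+_ (ℤ.*-identityʳ (+ m)) (ℤ.*-identityʳ (+ n)))

  ι-* : ∀ m n → ι (m ℕ.* n) ≡ ι m * ι n
  ι-* m n = toℚᵘ-injective (begin
    toℚᵘ (ι (m ℕ.* n))                               ≈⟨ toℚᵘ-ι (m ℕ.* n) ⟩
    ℚᵘ.mkℚᵘ (+ (m ℕ.* n)) 0                          ≈⟨ ℚᵘ.*≡* (cong (ℤ._* (+ 1)) (ℤ.pos-* m n)) ⟩
    ℚᵘ.mkℚᵘ (+ m) 0 ℚᵘ.* ℚᵘ.mkℚᵘ (+ n) 0             ≈⟨ ℚᵘ.*-cong (toℚᵘ-ι m) (toℚᵘ-ι n) ⟨
    toℚᵘ (ι m) ℚᵘ.* toℚᵘ (ι n)                       ≈⟨ toℚᵘ-homo-* (ι m) (ι n) ⟨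
    toℚᵘ (ι m * ι n)                                 ∎)
    where open ℚᵘ.≃-Reasoning

  /-*-cancel : ∀ n d .{{_ : ℕ.NonZero d}} → (+ n / d) * ι d ≡ ι n
  /-*-cancel n d@(suc d-1) = toℚᵘ-injective (begin
    toℚᵘ ((+ n / d) * ι d)                     ≈⟨ toℚᵘ-homo-* (+ n / d) (ι d) ⟩
    toℚᵘ (+ n / d) ℚᵘ.* toℚᵘ (ι d)             ≈⟨ ℚᵘ.*-cong (toℚᵘ-fromℚᵘ (ℚᵘ.mkℚᵘ (+ n) d-1)) (toℚᵘ-ι d) ⟩
    ℚᵘ.mkℚᵘ (+ n) d-1 ℚᵘ.* ℚᵘ.mkℚᵘ (+ d) 0     ≈⟨ ℚᵘ.*≡* (ℤ.*-assoc (+ n) (+ d) (+ 1)) ⟩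
    ℚᵘ.mkℚᵘ (+ n) 0                            ≈⟨ toℚᵘ-ι n ⟨
    toℚᵘ (ι n)                                 ∎)
    where open ℚᵘ.≃-Reasoning

  ι-+1 : ∀ n → ι (n ℕ.+ 1) ≡ ι n + 1ℚ
  ι-+1 n = trans (ι-+ n 1) (cong (_+_ (ι n)) (ι-def 1))

  0≤ι : ∀ n → 0ℚ ≤ ι n
  0≤ι n = subst (_≤ ι n) (ι-def 0) (ι-mono ℕ.z≤n)

  1≤ι2^ : ∀ n → 1ℚ ≤ ι (2 ℕ.^ n)
  1≤ι2^ n = subst (_≤ ι (2 ℕ.^ n)) (ι-def 1) (ι-mono (ℕ.m^n>0 2 n))

  1≤p⇒pos : ∀ {p} → 1ℚ ≤ p → Positive p
  1≤p⇒pos 1≤p = positive (<-≤-trans (positive⁻¹ 1ℚ) 1≤p)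

  *-monoˡ : ∀ {r p q} → 0ℚ ≤ r → p ≤ q → r * p ≤ r * q
  *-monoˡ {r} 0≤r = *-monoˡ-≤-nonNeg r {{nonNegative 0≤r}}

  *-monoʳ : ∀ {r p q} → 0ℚ ≤ r → p ≤ q → p * r ≤ q * r
  *-monoʳ {r} 0≤r = *-monoʳ-≤-nonNeg r {{nonNegative 0≤r}}

  0≤* : ∀ {p q} → 0ℚ ≤ p → 0ℚ ≤ q → 0ℚ ≤ p * q
  0≤* {p} {q} 0≤p 0≤q = subst (_≤ p * q) (*-zeroʳ p) (*-monoˡ 0≤p 0≤q)

  0≤+ : ∀ {p q} → 0ℚ ≤ p → 0ℚ ≤ q → 0ℚ ≤ p + q
  0≤+ = +-mono-≤

  0≤∣∣₂ : ∀ q → 0ℚ ≤ ∣ q ∣₂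
  0≤∣∣₂ zero      = ≤-refl
  0≤∣∣₂ q@(suc _) = nonNegative⁻¹ ∣ q ∣₂ {{normalize-nonNeg 1 (2 ℕ.^ ν₂ q) {{ℕ.m^n≢0 2 (ν₂ q)}}}}

  0≤∥∥ : ∀ p → 0ℚ ≤ ∥ p ∥ℚ
  0≤∥∥ p = 0≤∣p∣ (p - round p / 1)

  ∣∣₂-bound : ∀ q k → 2 ℕ.^ k ∣ q → ∣ q ∣₂ * ι (2 ℕ.^ k) ≤ 1ℚ
  ∣∣₂-bound zero      k _     = ≤-trans (≤-reflexive (*-zeroˡ (ι (2 ℕ.^ k)))) (<⇒≤ (positive⁻¹ 1ℚ))
  ∣∣₂-bound q@(suc _) k 2^k∣q = begin
    ∣ q ∣₂ * ι (2 ℕ.^ k)        ≤⟨ *-monoˡ (0≤∣∣₂ q) (ι-mono (ℕ.^-monoʳ-≤ 2 k≤ν)) ⟩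
    ∣ q ∣₂ * ι (2 ℕ.^ ν₂ q)     ≡⟨ /-*-cancel 1 (2 ℕ.^ ν₂ q) ⟩
    ι 1                         ≡⟨ ι-def 1 ⟩
    1ℚ                          ∎
    where
    open ≤-Reasoning
    instance 2^ν≢0 = ℕ.m^n≢0 2 (ν₂ q)
    k≤ν : k ℕ.≤ ν₂ q
    -- The search for the exponent starts at `q`, which is high enough because k < 2 ^ k ≤ q.
    k≤ν = maxPow-maximal q k q 2^k∣q (ℕ.<⇒≤ (ℕ.<-≤-trans (n<2^n k) (∣⇒≤ 2^k∣q)))

  -- Truncated expansions and nearby integers

  binarySum-prefix : ∀ w n → binarySum w n * ι (2 ℕ.^ n) ≡ ι (prefix w n)
  binarySum-prefix w zero    = trans (*-zeroˡ (ι 1)) (sym (ι-def 0))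
  binarySum-prefix w (suc n) = begin
    (S + D) * ι (2 ℕ.^ suc n)               ≡⟨ *-distribʳ-+ (ι (2 ℕ.^ suc n)) S D ⟩
    S * ι (2 ℕ.^ suc n) + D * ι (2 ℕ.^ suc n)   ≡⟨ cong₂ _+_ (cong (S *_) (ι-* 2 (2 ℕ.^ n))) (/-*-cancel (toℕ (w n)) (2 ℕ.^ suc n)) ⟩
    S * (ι 2 * ι (2 ℕ.^ n)) + ι (toℕ (w n))     ≡⟨ cong (_+ ι (toℕ (w n))) (lemma S (ι 2) (ι (2 ℕ.^ n))) ⟩
    ι 2 * (S * ι (2 ℕ.^ n)) + ι (toℕ (w n))     ≡⟨ cong (λ z → ι 2 * z + ι (toℕ (w n))) (binarySum-prefix w n) ⟩
    ι 2 * ι (prefix w n) + ι (toℕ (w n))        ≡⟨ cong (_+ ι (toℕ (w n))) (ι-* 2 (prefix w n)) ⟨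
    ι (2 ℕ.* prefix w n) + ι (toℕ (w n))        ≡⟨ ι-+ (2 ℕ.* prefix w n) (toℕ (w n)) ⟨
    ι (2 ℕ.* prefix w n ℕ.+ toℕ (w n))          ∎
    where
    open ≡-Reasoning
    instance 2^≢0 = ℕ.m^n≢0 2 (suc n)
    S = binarySum w n
    D = + toℕ (w n) / 2 ℕ.^ suc n
    lemma : ∀ a b c → a * (b * c) ≡ b * (a * c)
    lemma = solve 3 (λ a b c → a :* (b :* c) := b :* (a :* c)) refl
      where open +-*-Solver

  -- After scaling by `2 ^ m`, the letters from position `m` on contribute a number in [0, 1).
  -- Scaling once more by `R` turns it into the integer `tail`, which is less than `2 ^ n`.
  binarySum-tail : ∀ w m n → let a = ι (prefix w m) ; s = binarySum w (m ℕ.+ n) * ι (2 ℕ.^ m) in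
                   a ≤ s × s ≤ a + 1ℚ
  binarySum-tail w m n =
    *-cancelʳ-≤-pos R {{1≤p⇒pos (1≤ι2^ n)}} (begin
      a * R                                   ≡⟨ ι-* (prefix w m) (2 ℕ.^ n) ⟨
      ι (prefix w m ℕ.* 2 ℕ.^ n)              ≤⟨ ι-mono (ℕ.m≤m+n _ _) ⟩
      ι (prefix w m ℕ.* 2 ℕ.^ n ℕ.+ tail)     ≡⟨ s*R ⟨
      s * R                                   ∎) ,
    *-cancelʳ-≤-pos R {{1≤p⇒pos (1≤ι2^ n)}} (begin
      s * R                                          ≡⟨ s*R ⟩
      ι (prefix w m ℕ.* 2 ℕ.^ n ℕ.+ tail)            ≤⟨ ι-mono (ℕ.+-monoʳ-≤ _ (ℕ.<⇒≤ (prefix<2^n _ n))) ⟩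
      ι (prefix w m ℕ.* 2 ℕ.^ n ℕ.+ 2 ℕ.^ n)         ≡⟨ ι-+ (prefix w m ℕ.* 2 ℕ.^ n) (2 ℕ.^ n) ⟩
      ι (prefix w m ℕ.* 2 ℕ.^ n) + R                 ≡⟨ cong (_+ R) (ι-* (prefix w m) (2 ℕ.^ n)) ⟩
      a * R + R                                      ≡⟨ solve 2 (λ a r → a :* r :+ r := (a :+ con 1ℚ) :* r) refl a R ⟩
      (a + 1ℚ) * R                                   ∎)
    where
    open ≤-Reasoning
    open +-*-Solver using (solve; _:*_; _:+_; _:=_; con)
    a = ι (prefix w m)
    s = binarySum w (m ℕ.+ n) * ι (2 ℕ.^ m)
    R = ι (2 ℕ.^ n)
    tail = prefix (w ∘ (m ℕ.+_)) n
    s*R : s * R ≡ ι (prefix w m ℕ.* 2 ℕ.^ n ℕ.+ tail)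
    s*R = trans (*-assoc (binarySum w (m ℕ.+ n)) _ R)
      (trans (cong (binarySum w (m ℕ.+ n) *_)
        (trans (sym (ι-* (2 ℕ.^ m) (2 ℕ.^ n))) (cong ι (sym (ℕ.^-distribˡ-+-* 2 m n)))))
      (trans (binarySum-prefix w (m ℕ.+ n)) (cong ι (prefix-+ w m n))))

  -- This is the 4 ^ -m estimate, with p = 2 ^ m and q = j (p + 1). By `eq`, p ^ 3 (q y - i) equals
  -- (p + 1)(e - a) - d. Since e - a lies between -1 and 2 and d between 0 and p, this is at most 2
  -- p + 2 and at least -(2 p + 1), so at most 5 p in absolute value; a factor p is then cancelled.
  close-to-integer : ∀ {p a i d j y} → 1ℚ ≤ p → 0ℚ ≤ d → d ≤ p →
    (p + 1ℚ) * a + d ≡ p * p * p * i →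
    a ≤ y * (j * (p * p * p)) + 1ℚ → y * (j * (p * p * p)) ≤ a + 1ℚ + 1ℚ →
    p * p * ∣ j * (p + 1ℚ) * y - i ∣ ≤ + 5 / 1
  close-to-integer {p} {a} {i} {d} {j} {y} 1≤p 0≤d d≤p eq lo hi = *-cancelˡ-≤-pos p {{1≤p⇒pos 1≤p}} (begin
    p * (p * p * ∣ z ∣)              ≡⟨ solve 2 (λ p z → p :* (p :* p :* z) := p :* p :* p :* z) refl p ∣ z ∣ ⟩
    p * p * p * ∣ z ∣                ≡⟨ cong (_* ∣ z ∣) (0≤p⇒∣p∣≡p (0≤* (0≤* 0≤p 0≤p) 0≤p)) ⟨
    ∣ p * p * p ∣ * ∣ z ∣            ≡⟨ ∣p*q∣≡∣p∣*∣q∣ (p * p * p) z ⟨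
    ∣ p * p * p * z ∣                ≡⟨ cong ∣_∣ shape ⟩
    ∣ (p + 1ℚ) * (e - a) - d ∣       ≤⟨ ∣p∣≤ upper lower ⟩
    p * (+ 5 / 1)                    ∎)
    where
    open ≤-Reasoning
    open +-*-Solver
    z = j * (p + 1ℚ) * y - i
    e = y * (j * (p * p * p))
    0≤p : 0ℚ ≤ p
    0≤p = ≤-trans (<⇒≤ (positive⁻¹ 1ℚ)) 1≤p
    0≤p+1 : 0ℚ ≤ p + 1ℚ
    0≤p+1 = 0≤+ 0≤p (<⇒≤ (positive⁻¹ 1ℚ))
    shape : p * p * p * z ≡ (p + 1ℚ) * (e - a) - d
    shape = begin-equality
      p * p * p * z                        ≡⟨ solve 4 (λ p j y i → p :* p :* p :* (j :* (p :+ con 1ℚ) :* y :- i) :=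
                                                (p :+ con 1ℚ) :* (y :* (j :* (p :* p :* p))) :- p :* p :* p :* i) refl p j y i ⟩
      (p + 1ℚ) * e - p * p * p * i         ≡⟨ cong (λ t → (p + 1ℚ) * e - t) eq ⟨
      (p + 1ℚ) * e - ((p + 1ℚ) * a + d)    ≡⟨ solve 4 (λ p e a d → (p :+ con 1ℚ) :* e :- ((p :+ con 1ℚ) :* a :+ d) :=
                                                (p :+ con 1ℚ) :* (e :- a) :- d) refl p e a d ⟩
      (p + 1ℚ) * (e - a) - d               ∎
    upper : (p + 1ℚ) * (e - a) - d ≤ p * (+ 5 / 1)
    upper = begin
      (p + 1ℚ) * (e - a) - d              ≤⟨ +-mono-≤ (*-monoˡ 0≤p+1 (+-monoˡ-≤ (- a) hi)) (neg-antimono-≤ 0≤d) ⟩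
      (p + 1ℚ) * (a + 1ℚ + 1ℚ - a) - 0ℚ   ≡⟨ solve 2 (λ p a → (p :+ con 1ℚ) :* (a :+ con 1ℚ :+ con 1ℚ :- a) :- con 0ℚ :=
                                               p :+ p :+ (con 1ℚ :+ con 1ℚ :+ con 0ℚ)) refl p a ⟩
      p + p + (1ℚ + 1ℚ + 0ℚ)              ≤⟨ +-monoʳ-≤ (p + p) (+-mono-≤ (+-mono-≤ 1≤p 1≤p) 0≤p) ⟩
      p + p + (p + p + p)                 ≡⟨ solve 1 (λ p → p :+ p :+ (p :+ p :+ p) := p :* con (+ 5 / 1)) refl p ⟩
      p * (+ 5 / 1)                       ∎
    lower : - ((p + 1ℚ) * (e - a) - d) ≤ p * (+ 5 / 1)
    lower = begin
      - ((p + 1ℚ) * (e - a) - d)          ≡⟨ solve 4 (λ p e a d → :- ((p :+ con 1ℚ) :* (e :- a) :- d) :=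
                                               (p :+ con 1ℚ) :* (a :- e) :+ d) refl p e a d ⟩
      (p + 1ℚ) * (a - e) + d              ≤⟨ +-mono-≤ (*-monoˡ 0≤p+1 (+-monoˡ-≤ (- e) lo)) d≤p ⟩
      (p + 1ℚ) * (e + 1ℚ - e) + p         ≡⟨ solve 2 (λ p e → (p :+ con 1ℚ) :* (e :+ con 1ℚ :- e) :+ p :=
                                               p :+ p :+ (con 1ℚ :+ con 0ℚ :+ con 0ℚ)) refl p e ⟩
      p + p + (1ℚ + 0ℚ + 0ℚ)              ≤⟨ +-monoʳ-≤ (p + p) (+-mono-≤ (+-mono-≤ 1≤p 0≤p) 0≤p) ⟩
      p + p + (p + p + p)                 ≡⟨ solve 1 (λ p → p :+ p :+ (p :+ p :+ p) := p :* con (+ 5 / 1)) refl p ⟩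
      p * (+ 5 / 1)                       ∎

  -- The lower bound provided by a counterexample

  LittlewoodBound : ℝ → ℚ → ℕ → Set
  LittlewoodBound x η N = ∀ q → N ℕ.< q → ∃[ K ] (∀ k → K ℕ.≤ k → η ≤ approx (littlewood x q) k)

  0<½p : ∀ {p} → 0ℚ < p → 0ℚ < p * ½
  0<½p 0<p = *-monoˡ-<-pos ½ 0<p

  0≤littlewood : ∀ x q k → 0ℚ ≤ approx (littlewood x q) k
  0≤littlewood x q k = 0≤* (subst (0ℚ ≤_) (ι-def q) (0≤ι q)) (0≤* (0≤∣∣₂ q) (0≤∥∥ ((+ q / 1) * approx x k)))

  0<-stable : ∀ {ε s f} → 0ℚ + ε ≤ s → s ≤ f + ε * ½ → ε * ½ ≤ f
  0<-stable {ε} {s} {f} ε≤s s≤f = begin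
    ε * ½                ≡⟨ solve 1 (λ ε → ε :* con ½ := con 0ℚ :+ ε :- ε :* con ½) refl ε ⟩
    0ℚ + ε - ε * ½       ≤⟨ +-monoˡ-≤ (- (ε * ½)) (≤-trans ε≤s s≤f) ⟩
    f + ε * ½ - ε * ½    ≡⟨ solve 2 (λ f δ → f :+ δ :- δ := f) refl f (ε * ½) ⟩
    f                    ∎
    where
    open ≤-Reasoning
    open +-*-Solver

  <0-stable : ∀ {ε s f} → s + ε ≤ 0ℚ → f ≤ s + ε * ½ → f ≤ - (ε * ½)
  <0-stable {ε} {s} {f} s≤-ε f≤s = begin
    f                    ≤⟨ f≤s ⟩
    s + ε * ½            ≡⟨ solve 2 (λ s ε → s :+ ε :* con ½ := s :+ ε :- ε :* con ½) refl s ε ⟩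
    s + ε - ε * ½        ≤⟨ +-monoˡ-≤ (- (ε * ½)) s≤-ε ⟩
    0ℚ - ε * ½           ≡⟨ +-identityˡ (- (ε * ½)) ⟩
    - (ε * ½)            ∎
    where
    open ≤-Reasoning
    open +-*-Solver

  -- A negative lower limit is impossible, as every approximation of `littlewood x q` is
  -- nonnegative. Otherwise the limit exceeds some real that is eventually at least ε; comparing
  -- that real with `littlewood x q` up to ε / 2 leaves the rational bound ε / 2.
  counterexample⇒bound : ∀ x → Is2LCCounterexample x → ∃[ η ] (0ℚ < η × ∃[ N ] LittlewoodBound x η N)
  counterexample⇒bound x (inj₁ (s , (ε , 0<ε , N , s+ε≤0) , below)) =
    let n , _ , f≤s = below 0
        M , f≤s+½ε  = f≤s (ε * ½) (0<½p 0<ε)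
        k           = N ℕ.+ M
    in contradiction
      (≤-<-trans (0≤littlewood x (suc n) k)
        (≤-<-trans (<0-stable {ε} {approx s k} (s+ε≤0 k (ℕ.m≤m+n N M)) (f≤s+½ε k (ℕ.m≤n+m M N)))
          (neg-antimono-< (0<½p 0<ε))))
      (<-irrefl refl)
  counterexample⇒bound x (inj₂ (s , (ε , 0<ε , M , ε≤s) , N , above)) = ε * ½ , 0<½p 0<ε , N , bound
    where
    bound : LittlewoodBound x (ε * ½) N
    -- The sequence is indexed by `n` with `q = suc n`, so `N < q` amounts to `N ≤ n`.
    bound (suc n) (ℕ.s≤s N≤n) =
      let M′ , s≤f = above n N≤n (ε * ½) (0<½p 0<ε)
      in M ℕ.+ M′ , λ k K≤k → 0<-stable {ε} {approx s k}
        (ε≤s k (ℕ.≤-trans (ℕ.m≤m+n M M′) K≤k)) (s≤f k (ℕ.≤-trans (ℕ.m≤n+m M′ M) K≤k))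

  -- The estimate at q = 2 ^ j (2 ^ m + 1)

  expansion-approx : ∀ w x → w IsBinaryExpansionOf x → ∀ n → ∃[ K ] (∀ k → K ℕ.≤ k →
    let a = ι (prefix w n) ; e = approx x k * ι (2 ℕ.^ n) in a ≤ e + 1ℚ × e ≤ a + 1ℚ + 1ℚ)
  expansion-approx w x w⟶x n = K₁ ℕ.+ K₂ , λ k K≤k →
    (begin
      a                               ≤⟨ proj₁ tail ⟩
      s * Z                           ≡⟨ solve 3 (λ s δ z → s :* z := (s :- δ) :* z :+ δ :* z) refl s δ Z ⟩
      (s - δ) * Z + δ * Z             ≤⟨ +-monoˡ-≤ (δ * Z) (*-monoʳ (0≤ι (2 ℕ.^ n)) (h₁ k (ℕ.≤-trans (ℕ.m≤m+n K₁ K₂) K≤k))) ⟩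
      (approx x k + δ) * Z + δ * Z    ≡⟨ solve 3 (λ s δ z → (s :+ δ) :* z :+ δ :* z := s :* z :+ (δ :* z :+ δ :* z)) refl (approx x k) δ Z ⟩
      approx x k * Z + (δ * Z + δ * Z) ≡⟨ cong (λ z → approx x k * Z + z) δZ+δZ≡1 ⟩
      approx x k * Z + 1ℚ             ∎) ,
    (begin
      approx x k * Z                  ≤⟨ *-monoʳ (0≤ι (2 ℕ.^ n)) (h₂ k (ℕ.≤-trans (ℕ.m≤n+m K₂ K₁) K≤k)) ⟩
      (s + δ + δ) * Z                 ≡⟨ solve 3 (λ s δ z → (s :+ δ :+ δ) :* z := s :* z :+ (δ :* z :+ δ :* z)) refl s δ Z ⟩
      s * Z + (δ * Z + δ * Z)         ≡⟨ cong (λ z → s * Z + z) δZ+δZ≡1 ⟩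
      s * Z + 1ℚ                      ≤⟨ +-monoˡ-≤ 1ℚ (proj₂ tail) ⟩
      a + 1ℚ + 1ℚ                     ∎)
    where
    open ≤-Reasoning
    open +-*-Solver
    instance 2^n≢0 = ℕ.m^n≢0 2 n
    a = ι (prefix w n)
    Z = ι (2 ℕ.^ n)
    1/Z = + 1 / 2 ℕ.^ n
    -- The error is incurred twice, in the convergence of the partial sums and in `_≤ᴿ_`; after
    -- scaling by `Z` the two add up to 1.
    δ = 1/Z * ½
    0<δ : 0ℚ < δ
    0<δ = 0<½p (positive⁻¹ 1/Z {{normalize-pos 1 (2 ℕ.^ n)}})
    δZ+δZ≡1 : δ * Z + δ * Z ≡ 1ℚ
    δZ+δZ≡1 = trans (solve 2 (λ y z → y :* con ½ :* z :+ y :* con ½ :* z := y :* z) refl 1/Z Z) (trans (/-*-cancel 1 (2 ℕ.^ n)) (ι-def 1))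
    N = proj₁ (w⟶x δ 0<δ)
    -- The index `n ℕ.+ N` is past the convergence threshold and also splits as `binarySum-tail`
    -- requires.
    near = proj₂ (w⟶x δ 0<δ) (n ℕ.+ N) (ℕ.m≤n+m N n)
    s = binarySum w (n ℕ.+ N)
    tail = binarySum-tail w n N
    K₁ = proj₁ (proj₁ near δ 0<δ)
    h₁ = proj₂ (proj₁ near δ 0<δ)
    K₂ = proj₁ (proj₂ near δ 0<δ)
    h₂ = proj₂ (proj₂ near δ 0<δ)

  -- The lower bound is evaluated at one index `k` beyond both thresholds and multiplied by p = 2 ^
  -- m. Once the factor 2 ^ j of `q` is absorbed, p (p + 1) z ≤ 2 p ^ 2 z remains, which
  -- `close-to-integer` bounds by 10.
  XX̄X-bounded : ∀ x w → w IsBinaryExpansionOf x → ∀ {η N} → 0ℚ < η → LittlewoodBound x η N →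
                ∀ j m → N ℕ.< m → Echo opposite w j m (m ℕ.+ m) → ι m * η ≤ + 10 / 1
  XX̄X-bounded x w w⟶x {η} {N} 0<η lower j m N<m echo = begin
    -- Weakening 2 ^ m to `m` makes the conclusion linear, ready for `archimedean`.
    ι m * η                              ≤⟨ *-monoʳ (<⇒≤ 0<η) (ι-mono (ℕ.<⇒≤ (n<2^n m))) ⟩
    p * η                                ≤⟨ *-monoˡ 0≤p (proj₂ (lower q N<q) k (ℕ.m≤m+n K₁ K₂)) ⟩
    p * ((+ q / 1) * (∣ q ∣₂ * z))       ≡⟨ cong (λ r → p * (r * (∣ q ∣₂ * z))) q≡ ⟩
    p * (J * (p + 1ℚ) * (∣ q ∣₂ * z))    ≡⟨ solve 4 (λ p j v z → p :* (j :* (p :+ con 1ℚ) :* (v :* z)) :=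
                                               v :* j :* (p :* (p :+ con 1ℚ) :* z)) refl p J ∣ q ∣₂ z ⟩
    -- Since 2 ^ j divides `q`, the position `j` of the factor drops out of the estimate.
    ∣ q ∣₂ * J * (p * (p + 1ℚ) * z)      ≤⟨ *-monoʳ (0≤* (0≤* 0≤p (0≤+ 0≤p (<⇒≤ (positive⁻¹ 1ℚ)))) 0≤z)
                                              (∣∣₂-bound q j (m∣m*n (2 ℕ.^ m ℕ.+ 1))) ⟩
    1ℚ * (p * (p + 1ℚ) * z)              ≡⟨ *-identityˡ (p * (p + 1ℚ) * z) ⟩
    p * (p + 1ℚ) * z                     ≤⟨ *-monoʳ 0≤z (*-monoˡ 0≤p (+-monoʳ-≤ p (1≤ι2^ m))) ⟩
    p * (p + p) * z                      ≡⟨ solve 2 (λ p z → p :* (p :+ p) :* z := p :* p :* z :+ p :* p :* z) refl p z ⟩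
    p * p * z + p * p * z                ≤⟨ +-mono-≤ ppz≤5 ppz≤5 ⟩
    + 10 / 1                             ∎
    where
    open ≤-Reasoning
    open +-*-Solver
    P = 2 ℕ.^ m
    q = 2 ℕ.^ j ℕ.* (P ℕ.+ 1)
    n = j ℕ.+ (m ℕ.+ (m ℕ.+ m))
    p = ι P
    J = ι (2 ℕ.^ j)
    a = ι (prefix w n)
    N<q : N ℕ.< q
    N<q = ℕ.<-≤-trans (ℕ.<-trans N<m (n<2^n m)) (ℕ.≤-trans (ℕ.m≤m+n P 1) (ℕ.m≤n*m (P ℕ.+ 1) (2 ℕ.^ j) {{ℕ.m^n≢0 2 j}}))
    I = proj₁ (XX̄X-prefix w j m echo)
    d = proj₁ (proj₂ (XX̄X-prefix w j m echo))
    d≤P = proj₁ (proj₂ (proj₂ (XX̄X-prefix w j m echo)))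
    identity = proj₂ (proj₂ (proj₂ (XX̄X-prefix w j m echo)))
    K₁ = proj₁ (lower q N<q)
    K₂ = proj₁ (expansion-approx w x w⟶x n)
    k = K₁ ℕ.+ K₂
    y = approx x k
    near = proj₂ (expansion-approx w x w⟶x n) k (ℕ.m≤n+m K₂ K₁)
    z = ∥ (+ q / 1) * y ∥ℚ
    0≤p : 0ℚ ≤ p
    0≤p = 0≤ι P
    0≤z : 0ℚ ≤ z
    0≤z = 0≤∥∥ ((+ q / 1) * y)
    q≡ : + q / 1 ≡ J * (p + 1ℚ)
    q≡ = trans (sym (ι-def q)) (trans (ι-* (2 ℕ.^ j) (P ℕ.+ 1)) (cong (J *_) (ι-+1 P)))
    z≤ : z ≤ ∣ J * (p + 1ℚ) * y - ι I ∣
    z≤ = subst₂ (λ r s → ∥ r * y ∥ℚ ≤ ∣ J * (p + 1ℚ) * y - s ∣) (sym q≡) (sym (ι-def I))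
      (∥p∥-minimal (J * (p + 1ℚ) * y) (+ I))
    ιPPP : ι (P ℕ.* P ℕ.* P) ≡ p * p * p
    ιPPP = trans (ι-* (P ℕ.* P) P) (cong (_* p) (ι-* P P))
    2^n : ι (2 ℕ.^ n) ≡ J * (p * p * p)
    2^n = trans (cong ι (trans (ℕ.^-distribˡ-+-* 2 j _) (cong (2 ℕ.^ j ℕ.*_)
        (trans (ℕ.^-distribˡ-+-* 2 m _) (trans (cong (P ℕ.*_) (ℕ.^-distribˡ-+-* 2 m m)) (sym (ℕ.*-assoc P P P)))))))
      (trans (ι-* (2 ℕ.^ j) (P ℕ.* P ℕ.* P)) (cong (J *_) ιPPP))
    identity′ : (p + 1ℚ) * a + ι d ≡ p * p * p * ι I
    identity′ = begin-equality
      (p + 1ℚ) * a + ι d                              ≡⟨ cong (λ r → r * a + ι d) (ι-+1 P) ⟨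
      ι (P ℕ.+ 1) * a + ι d                           ≡⟨ cong (_+ ι d) (ι-* (P ℕ.+ 1) (prefix w n)) ⟨
      ι ((P ℕ.+ 1) ℕ.* prefix w n) + ι d              ≡⟨ ι-+ ((P ℕ.+ 1) ℕ.* prefix w n) d ⟨
      ι ((P ℕ.+ 1) ℕ.* prefix w n ℕ.+ d)              ≡⟨ cong ι identity ⟩
      ι (P ℕ.* P ℕ.* P ℕ.* I)                         ≡⟨ ι-* (P ℕ.* P ℕ.* P) I ⟩
      ι (P ℕ.* P ℕ.* P) * ι I                         ≡⟨ cong (_* ι I) ιPPP ⟩
      p * p * p * ι I                                 ∎
    ppz≤5 : p * p * z ≤ + 5 / 1
    ppz≤5 = ≤-trans (*-monoˡ (0≤* 0≤p 0≤p) z≤) (close-to-integer {a = a} {j = J} (1≤ι2^ m) (0≤ι d) (ι-mono d≤P) identity′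
      (subst (λ r → a ≤ y * r + 1ℚ) 2^n (proj₁ near))
      (subst (λ r → y * r ≤ a + 1ℚ + 1ℚ) 2^n (proj₂ near)))

  -- The Archimedean property and the bound on lengths

  1≤p*↧p : ∀ p .{{_ : Positive p}} → 1ℚ ≤ p * ι (↧ₙ p)
  1≤p*↧p p@(mkℚ ℤ.+[1+ n ] _ _) = begin
    1ℚ                                ≡⟨ ι-def 1 ⟨
    ι 1                               ≤⟨ ι-mono (ℕ.s≤s ℕ.z≤n) ⟩
    ι (suc n)                         ≡⟨ /-*-cancel (suc n) (↧ₙ p) ⟨
    (+ suc n / ↧ₙ p) * ι (↧ₙ p)       ≡⟨ cong (_* ι (↧ₙ p)) (↥p/↧p≡p p) ⟩
    p * ι (↧ₙ p)                      ∎
    where open ≤-Reasoning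

  -- A positive rational is at least the reciprocal of its denominator, so `n` times the denominator
  -- is a large enough multiplier; adding `N` also passes the threshold.
  archimedean : ∀ {p} → 0ℚ < p → ∀ n N → ∃[ m ] (N ℕ.≤ m × + n / 1 ≤ ι m * p)
  archimedean {p} 0<p n N = N ℕ.+ n ℕ.* ↧ₙ p , ℕ.m≤m+n N _ , (begin
    + n / 1                           ≡⟨ ι-def n ⟨
    ι n                               ≡⟨ *-identityʳ (ι n) ⟨
    ι n * 1ℚ                          ≤⟨ *-monoˡ (0≤ι n) (1≤p*↧p p {{positive 0<p}}) ⟩
    ι n * (p * ι (↧ₙ p))              ≡⟨ solve 3 (λ n p d → n :* (p :* d) := n :* d :* p) refl (ι n) p (ι (↧ₙ p)) ⟩
    ι n * ι (↧ₙ p) * p                ≡⟨ cong (_* p) (ι-* n (↧ₙ p)) ⟨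
    ι (n ℕ.* ↧ₙ p) * p                ≤⟨ *-monoʳ (<⇒≤ 0<p) (ι-mono (ℕ.m≤n+m _ N)) ⟩
    ι (N ℕ.+ n ℕ.* ↧ₙ p) * p          ∎)
    where
    open ≤-Reasoning
    open +-*-Solver

  -- A subword longer than `L` would contain X X̄ X with `m > k`, and this factor sits at `i + j` in
  -- `w`. Then `XX̄X-bounded` gives m η ≤ 10, against 11 ≤ k η ≤ m η.
  overlapFree-length≤ : ∀ x {w} → w IsBinaryExpansionOf x →
    ∀ {η N} → 0ℚ < η → LittlewoodBound x η N → ∀ {k} → N ℕ.≤ k → + 11 / 1 ≤ ι k * η →
    ∀ {L} → (∀ v → AvoidsOverlaps v L →
             ∃[ j ] ∃[ m ] (k ℕ.< m × m ℕ.+ m ℕ.+ (m ℕ.+ j) ℕ.≤ L × Echo opposite v j m (m ℕ.+ m))) →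
    ∀ v → v IsSubwordOf∞ w → OverlapFree v → length v ℕ.≤ L
  overlapFree-length≤ x {w} w⟶x {η} 0<η lower {k} N≤k 11≤kη find _ (i , n , refl) free =
    subst (ℕ._≤ _) (sym (length-applyUpTo v n)) (ℕ.≮⇒≥ λ L<n →
      -- `find` reads only the first `L` letters, and `L < n` keeps any overlap among them inside
      -- the subword.
      let j , m , k<m , _ , echo = find v λ j p b → overlapFree⇒avoids v n free j p (ℕ.<-trans b L<n)
          echo′ : Echo opposite w (i ℕ.+ j) m (m ℕ.+ m)
          echo′ t t<2m = trans (cong w (shift₂ t m i j))
            (trans (echo t t<2m) (cong (opposite ∘ w) (shift₁ i t j)))
      in <-irrefl refl (begin-strict
        + 10 / 1         <⟨ from-yes (+ 10 / 1 <? + 11 / 1) ⟩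
        + 11 / 1         ≤⟨ 11≤kη ⟩
        ι k * η          ≤⟨ *-monoʳ (<⇒≤ 0<η) (ι-mono (ℕ.<⇒≤ k<m)) ⟩
        ι m * η          ≤⟨ XX̄X-bounded x w w⟶x 0<η lower (i ℕ.+ j) m (ℕ.≤-<-trans N≤k k<m) echo′ ⟩
        + 10 / 1         ∎))
    where
    open ≤-Reasoning
    v : Word
    v t = w (i ℕ.+ t)
    shift₁ : ∀ i t j → i ℕ.+ (t ℕ.+ j) ≡ t ℕ.+ (i ℕ.+ j)
    shift₁ = solve-∀
    shift₂ : ∀ t m i j → t ℕ.+ (m ℕ.+ (i ℕ.+ j)) ≡ i ℕ.+ (t ℕ.+ (m ℕ.+ j))
    shift₂ = solve-∀

open OverlapFreeWords
open Approximation

open import Data.Nat.Base using (_≤_)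
open import Data.Rational.Base using (0ℚ; _<_)

theorem2p13 : ∀ x → 0ᴿ ≤ᴿ x → x ≤ᴿ 1ᴿ → Is2LCCounterexample x →
    ∀ w → w IsBinaryExpansionOf x →
    ∃[ L ] (∀ (v : List (Fin 2)) → v IsSubwordOf∞ w → OverlapFree v → length v ≤ L)
theorem2p13 x _ _ cex w w⟶x = bounded (counterexample⇒bound x cex)
  where
  bounded : ∃[ η ] (0ℚ < η × ∃[ N ] LittlewoodBound x η N) →
            ∃[ L ] (∀ v → v IsSubwordOf∞ w → OverlapFree v → length v ≤ L)
  bounded (η , 0<η , N , lower) =
    -- The 11 is chosen to exceed the 10 of `XX̄X-bounded`. Both `k` and `L` depend only on `η` and
    -- `N`, not on the subword.
    let k , N≤k , 11≤kη = archimedean 0<η 11 N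
        L , find        = long-XX̄X k
    in L , overlapFree-length≤ x w⟶x 0<η lower N≤k 11≤kη find
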